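{- Let $n\ge2$ and $B_n=\langle a,b\mid ba=b^n\rangle$. 1. If $\mathsf d$ denotes the Levenshtein distance, then $\mathsf c_{\mathsf d}(B_n)=n-1$; and $B_n$ is half-factorial if and only if $n=2$. 2. For all $k,m\in\mathbb N_0$, \[\mathsf L(a^kb^m)=k+m-q_{m,n}(n-2)+(n-2)\cdot[0,q_{m,n}],\] where $q_{m,n}=\lfloor m/(n-1)\rfloor$ if $(n-1)\nmid m$; $q_{m,n}=\frac{m}{n-1}-1$ if $(n-1)\mid m$ and $m\neq0$; and $q_{m,n}=0$ if $m=0$.
   Context: $B_n$ is the monoid with generators $a,b$ and single relation $ba=b^n$; it is reduced and atomic with atoms $a,b$, and every element is uniquely $a^kb^m$ ($k,m\in\mathbb N_0$). Factorizations are words in the free monoid $\mathcal F^*(\{a,b\})$; $\pi$ maps a word to the element it represents; $\sim=\{(x,y)\mid\pi(x)=\pi(y)\}$. $\mathsf L(x)=\{|z|:\pi(z)=x\}$ (with $\mathsf L(1)=\{0\}$). The Levenshtein distance between words $z,z'$ is the minimal number of substitutions, deletions or insertions of single letters needed to transform $z$ into $z'$. For $x\in B_n$, the catenary degree $\mathsf c_{\mathsf d}(x)$ is the least $N\in\mathbb N_0\cup\{\infty\}$ such that any two factorizations $z,z'$ of $x$ are connected by a chain $z=z_0,\dots,z_r=z'$ of factorizations of $x$ with $\mathsf d(z_{i-1},z_i)\le N$; $\mathsf c_{\mathsf d}(B_n)=\sup_x\mathsf c_{\mathsf d}(x)$. Half-factorial: $|\mathsf L(x)|=1$ for all $x$.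 Notation: $[u,v]=\{z\in\mathbb Z:u\le z\le v\}$, $d\cdot L=\{dl:l\in L\}$, $m+L=\{m+l:l\in L\}$. -}

module Defs where

open import Algebra.Bundles using (Monoid)
import Algebra.Definitions.RawMonoid as RawMonoidDefs
open import Data.Empty using (⊥-elim)
open import Data.Integer as ℤ using (ℤ)
open import Data.List using (List; []; _∷_; [_]; _++_; map; foldr; length; replicate)
open import Data.List.Membership.Propositional using (_∈_; lose; find)
open import Data.List.Membership.Propositional.Properties using (∈-map⁺; ∈-map⁻)
open import Data.List.Properties using (++-assoc; ++-identityʳ; ≡-dec)
open import Data.List.Relation.Unary.Any using (here; there; any?)
open import Data.Nat using (ℕ; zero; suc; _∸_; _/_; _≤_; z≤n; s≤s; >-nonZero)
open import Data.Nat.Divisibility using (_∣?_)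
open import Data.Nat.Properties using (m<n⇒0<n∸m)
open import Data.Product using (_×_; _,_; ∃; ∃!; proj₁; proj₂)
open import Level using (0ℓ)
open import Relation.Binary.Construct.Closure.ReflexiveTransitive using (Star)
open import Relation.Binary.Core using (Rel)
open import Relation.Binary.PropositionalEquality using (_≡_; refl)
open import Relation.Nullary using (Dec; yes; no)
open import Relation.Nullary.Construct.Add.Supremum as Sup using (_⁺)
open import Relation.Nullary.Decidable using (map′)
open import Relation.Unary using (Pred)

open import Relation.Binary.Construct.Add.Supremum.NonStrict _≤_ using () renaming (_≤⁺_ to _≤∞_) public

ℕ∞ : Set
ℕ∞ = ℕ ⁺

fin : ℕ → ℕ∞
fin n = Sup.[ n ]

IsLeast : {A : Set} → Rel A 0ℓ → Pred A 0ℓ → Pred A 0ℓ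
IsLeast _⊑_ P m = P m × (∀ k → P k → m ⊑ k)

IsSupremum : {A I : Set} → Rel A 0ℓ → (I → A) → Pred A 0ℓ
IsSupremum _⊑_ f = IsLeast _⊑_ (λ u → ∀ i → f i ⊑ u)

data Letter : Set where
  a b : Letter

Word : Set
Word = List Letter

infix 4 _∼⟨_⟩_

-- The least monoid congruence on words containing (ba , bⁿ).
data _∼⟨_⟩_ : Word → ℕ → Word → Set where
  ba∼bⁿ  : ∀ {n} → b ∷ a ∷ [] ∼⟨ n ⟩ replicate n b
  ∼-refl  : ∀ {n u} → u ∼⟨ n ⟩ u
  ∼-sym   : ∀ {n u v} → u ∼⟨ n ⟩ v → v ∼⟨ n ⟩ u
  ∼-trans : ∀ {n u v w} → u ∼⟨ n ⟩ v → v ∼⟨ n ⟩ w → u ∼⟨ n ⟩ w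
  ∼-cong  : ∀ {n u u′ v v′} → u ∼⟨ n ⟩ u′ → v ∼⟨ n ⟩ v′ → u ++ v ∼⟨ n ⟩ u′ ++ v′

-- The quotient of the free monoid by this congruence, as a setoid.
B : ℕ → Monoid 0ℓ 0ℓ
B n = record
  { Carrier  = Word
  ; _≈_      = _∼⟨ n ⟩_
  ; _∙_      = _++_
  ; ε        = []
  ; isMonoid = record
    { isSemigroup = record
      { isMagma = record
        { isEquivalence = record { refl = ∼-refl ; sym = ∼-sym ; trans = ∼-trans }
        ; ∙-cong        = ∼-cong
        }
      ; assoc = λ x y z → ≡⇒∼ (++-assoc x y z)
      }
    ; identity = (λ _ → ∼-refl) , (λ x → ≡⇒∼ (++-identityʳ x))
    }
  }
  where
  ≡⇒∼ : ∀ {u v} → u ≡ v → u ∼⟨ n ⟩ v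
  ≡⇒∼ refl = ∼-refl

data Edit : Word → Word → Set where
  substitution : ∀ u x y v → Edit (u ++ x ∷ v) (u ++ y ∷ v)
  deletion     : ∀ u x v → Edit (u ++ x ∷ v) (u ++ v)
  insertion    : ∀ u x v → Edit (u ++ v) (u ++ x ∷ v)

data Edits : ℕ → Word → Word → Set where
  []  : ∀ {z} → Edits 0 z z
  _∷_ : ∀ {k z w z′} → Edit z w → Edits k w z′ → Edits (suc k) z z′

Edit-cons : ∀ x {z w} → Edit z w → Edit (x ∷ z) (x ∷ w)
Edit-cons x (substitution u y y′ v) = substitution (x ∷ u) y y′ v
Edit-cons x (deletion u y v)        = deletion (x ∷ u) y v
Edit-cons x (insertion u y v)       = insertion (x ∷ u) y v

Edits-cons : ∀ x {k z w} → Edits k z w → Edits k (x ∷ z) (x ∷ w)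
Edits-cons x []       = []
Edits-cons x (e ∷ es) = Edit-cons x e ∷ Edits-cons x es

Edits-exist : ∀ z z′ → ∃ λ k → Edits k z z′
Edits-exist []      []       = 0 , []
Edits-exist []      (y ∷ z′) with Edits-exist [] z′
... | k , es = suc k , insertion [] y [] ∷ Edits-cons y es
Edits-exist (x ∷ z) z′       with Edits-exist z z′
... | k , es = suc k , deletion [] x z ∷ es

_≟ᴸ_ : (x y : Letter) → Dec (x ≡ y)
a ≟ᴸ a = yes refl
a ≟ᴸ b = no λ ()
b ≟ᴸ a = no λ ()
b ≟ᴸ b = yes refl

neighbours : Word → List Word
neighbours []      = [ a ] ∷ [ b ] ∷ []
neighbours (x ∷ v) =
  v ∷ (a ∷ v) ∷ (b ∷ v) ∷ (a ∷ x ∷ v) ∷ (b ∷ x ∷ v) ∷ map (x ∷_) (neighbours v)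

neighbours-sound : ∀ z {w} → w ∈ neighbours z → Edit z w
neighbours-sound []      (here refl)                             = insertion [] a []
neighbours-sound []      (there (here refl))                     = insertion [] b []
neighbours-sound (x ∷ v) (here refl)                             = deletion [] x v
neighbours-sound (x ∷ v) (there (here refl))                     = substitution [] x a v
neighbours-sound (x ∷ v) (there (there (here refl)))             = substitution [] x b v
neighbours-sound (x ∷ v) (there (there (there (here refl))))     = insertion [] a (x ∷ v)
neighbours-sound (x ∷ v) (there (there (there (there (here refl))))) = insertion [] b (x ∷ v)
neighbours-sound (x ∷ v) (there (there (there (there (there p))))) with ∈-map⁻ (x ∷_) p
... | _ , q , refl = Edit-cons x (neighbours-sound v q)

neighbours-cons : ∀ x {v w} → w ∈ neighbours v → (x ∷ w) ∈ neighbours (x ∷ v)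
neighbours-cons x p = there (there (there (there (there (∈-map⁺ (x ∷_) p)))))

neighbours-complete : ∀ {z w} → Edit z w → w ∈ neighbours z
neighbours-complete (substitution [] x a v)      = there (here refl)
neighbours-complete (substitution [] x b v)      = there (there (here refl))
neighbours-complete (substitution (c ∷ u) x y v) = neighbours-cons c (neighbours-complete (substitution u x y v))
neighbours-complete (deletion [] x v)            = here refl
neighbours-complete (deletion (c ∷ u) x v)       = neighbours-cons c (neighbours-complete (deletion u x v))
neighbours-complete (insertion [] a [])          = here refl
neighbours-complete (insertion [] b [])          = there (here refl)
neighbours-complete (insertion [] a (y ∷ v))     = there (there (there (here refl)))
neighbours-complete (insertion [] b (y ∷ v))     = there (there (there (there (here refl))))
neighbours-complete (insertion (c ∷ u) x v)      = neighbours-cons c (neighbours-complete (insertion u x v))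

Edits? : ∀ z z′ k → Dec (Edits k z z′)
Edits? z z′ zero    = map′ (λ { refl → [] }) (λ { [] → refl }) (≡-dec _≟ᴸ_ z z′)
Edits? z z′ (suc k) = map′
  (λ p → let (_ , w∈ , es) = find p in neighbours-sound z w∈ ∷ es)
  (λ { (e ∷ es) → lose (neighbours-complete e) es })
  (any? (λ w → Edits? w z′ k) (neighbours z))

least : {P : Pred ℕ 0ℓ} → (∀ k → Dec (P k)) → ∀ k → P k → ∃ (IsLeast _≤_ P)
least P? zero    p = 0 , p , λ _ _ → z≤n
least {P} P? (suc k) p with P? 0
... | yes p₀ = 0 , p₀ , λ _ _ → z≤n
... | no ¬p₀ with least (λ i → P? (suc i)) k p
...   | m , pm , m-min = suc m , pm , minimal
  where
  minimal : ∀ i → P i → suc m ≤ i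
  minimal zero    p₀ = ⊥-elim (¬p₀ p₀)
  minimal (suc i) pᵢ = s≤s (m-min i pᵢ)

minimalEdits : ∀ z z′ → ∃ (IsLeast _≤_ (λ k → Edits k z z′))
minimalEdits z z′ = let (k , es) = Edits-exist z z′ in least (Edits? z z′) k es

levenshtein : Word → Word → ℕ
levenshtein z z′ = proj₁ (minimalEdits z z′)

module _ (n : ℕ) where

  open Monoid (B n) using (Carrier; _≈_; _∙_; ε; rawMonoid)

  gen : Letter → Carrier
  gen x = [ x ]

  π : Word → Carrier
  π z = foldr _∙_ ε (map gen z)

  normalForm : ℕ → ℕ → Carrier
  normalForm k m = (k · gen a) ∙ (m · gen b)
    where open RawMonoidDefs rawMonoid using () renaming (_×_ to _·_)

  IsFactorization : Carrier → Pred Word 0ℓ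
  IsFactorization x z = π z ≈ x

  L : Carrier → Pred ℕ 0ℓ
  L x l = ∃ λ z → IsFactorization x z × length z ≡ l

  HalfFactorial : Set
  HalfFactorial = ∀ x → ∃! _≡_ (L x)

  module _ (d : Word → Word → ℕ) where

    Link : Carrier → ℕ∞ → Rel Word 0ℓ
    Link x N z z′ = IsFactorization x z × IsFactorization x z′ × fin (d z z′) ≤∞ N

    ChainConnected : Carrier → Pred ℕ∞ 0ℓ
    ChainConnected x N =
      ∀ z z′ → IsFactorization x z → IsFactorization x z′ → Star (Link x N) z z′

    IsCatenaryDegreeAt : Carrier → Pred ℕ∞ 0ℓ
    IsCatenaryDegreeAt x = IsLeast _≤∞_ (ChainConnected x)

    -- c is determined by leastness; asking for it as a function makes the
    -- existence of every c(x) part of the claim, so that the supremum is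
    -- never taken over a partial family.
    IsCatenaryDegree : Pred ℕ∞ 0ℓ
    IsCatenaryDegree N =
      ∃ λ (c : Carrier → ℕ∞) → (∀ x → IsCatenaryDegreeAt x (c x)) × IsSupremum _≤∞_ c N

infixr 6 _+ˢ_
infixr 7 _·ˢ_

[_⋯_] : ℤ → ℤ → Pred ℤ 0ℓ
[ u ⋯ v ] z = u ℤ.≤ z × z ℤ.≤ v

_+ˢ_ : ℤ → Pred ℤ 0ℓ → Pred ℤ 0ℓ
(m +ˢ S) z = ∃ λ l → S l × z ≡ m ℤ.+ l

_·ˢ_ : ℤ → Pred ℤ 0ℓ → Pred ℤ 0ℓ
(d ·ˢ S) z = ∃ λ l → S l × z ≡ d ℤ.* l

asℤ : Pred ℕ 0ℓ → Pred ℤ 0ℓ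
asℤ S z = ∃ λ l → S l × z ≡ ℤ.+ l

-- In the divisible case m ≠ 0, so the quotient is positive and ∸ 1 does not truncate.
q : (m n : ℕ) → .(2 ≤ n) → ℕ
q zero      n 2≤n = 0
q m@(suc _) n 2≤n with (n ∸ 1) ∣? m
... | yes _ = (m / (n ∸ 1)) {{>-nonZero (m<n⇒0<n∸m 2≤n)}} ∸ 1
... | no  _ = (m / (n ∸ 1)) {{>-nonZero (m<n⇒0<n∸m 2≤n)}}

{-# OPTIONS --safe #-}
-- Put p = n − 1.  Since baᵏ = b¹⁺ᵏᵖ, the normal form aᵏbᵐ of a word is computed by reading it from the
-- right: a letter a adds 1 to k, and a letter b turns (k , m) into (0 , 1 + kp + m).  Hence k is the number
-- of letters a before the first b, and each of the t letters a after it is absorbed into p letters b, so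
-- m is the number of letters b plus tp.  The length is therefore k + m − t(p − 1), and t takes exactly the
-- values with t = 0 or tp < m.  Replacing one absorbed a by bᵖ costs at most p edits and eventually leads
-- to aᵏbᵐ.  Conversely, in the factorizations of one element the number of letters b is determined modulo p,
-- so fewer than p edits cannot change it, nor t; this makes p optimal as soon as t = 1 is possible.
module Submission where

open import Defs
open import Data.List using ([]; _∷_; [_]; _++_; filter; foldr; length; replicate)
open import Data.List.Properties using (concat-map-[_]; filter-++; foldr-++; length-++; length-filter; length-replicate)
open import Data.Nat as ℕ using (ℕ; zero; suc; pred; _≤_; _<_; _∸_; _⊔_; ∣_-_∣; z≤n; s≤s; NonZero)
open import Data.Nat.DivMod using (m/n*n≡m; m/n*n≤m; m*n/n≡m; m<n*o⇒m/o<n; [m∸n]/n≡m/n∸1; /-monoˡ-≤; 0/n≡0)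
open import Data.Nat.Divisibility using (_∣_; _∣?_; divides)
open import Data.Nat.Properties
import Data.Nat.Tactic.RingSolver as ℕ-Solver
open import Data.Product using (_×_; _,_; ∃; proj₁; proj₂; uncurry)
open import Function using (_∘_)
open import Function.Bundles using (_⇔_; mk⇔; Equivalence)
open import Level using (0ℓ)
open import Relation.Binary.Construct.Add.Supremum.NonStrict _≤_ using (_≤⊤⁺; ≤⁺-trans; [≤]-injective) renaming ([_] to [_]≤)
open import Relation.Binary.Construct.Closure.ReflexiveTransitive as Star using (Star; ε; _◅_; _◅◅_)
open import Relation.Binary.PropositionalEquality using (_≡_; refl; sym; trans; cong; cong₂; subst; subst₂; module ≡-Reasoning)
open import Relation.Nullary using (¬_; yes; no; contradiction)
open import Relation.Nullary.Construct.Add.Supremum using (⊤⁺) renaming ([_] to [_]⁺)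
open import Relation.Unary using (Pred; _≐_; _⊆_)

replicate-∷ : ∀ {ℓ} {A : Set ℓ} m (x : A) v → replicate m x ++ x ∷ v ≡ x ∷ replicate m x ++ v
replicate-∷ zero    x v = refl
replicate-∷ (suc m) x v = cong (x ∷_) (replicate-∷ m x v)

module _ where

  open import Data.Nat using (_+_; _*_; _/_)

  m+s≡n+t⇒∣m-n∣≡∣s-t∣ : ∀ m n {s t} → m + s ≡ n + t → ∣ m - n ∣ ≡ ∣ s - t ∣
  m+s≡n+t⇒∣m-n∣≡∣s-t∣ m n {s} {t} eq = begin
    ∣ m - n ∣          ≡⟨ ∣m+n-m+o∣≡∣n-o∣ s m n ⟨
    ∣ s + m - s + n ∣  ≡⟨ cong₂ ∣_-_∣ (trans (+-comm s m) eq) (+-comm s n) ⟩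
    ∣ n + t - n + s ∣  ≡⟨ ∣m+n-m+o∣≡∣n-o∣ n t s ⟩
    ∣ t - s ∣          ≡⟨ ∣-∣-comm t s ⟩
    ∣ s - t ∣          ∎
    where open ≡-Reasoning

  m*n≤o⇒m≤o/n : ∀ {m n o} .{{_ : NonZero n}} → m * n ≤ o → m ≤ o / n
  m*n≤o⇒m≤o/n {m} {n} {o} mn≤o = subst (_≤ o / n) (m*n/n≡m m n) (/-monoˡ-≤ n mn≤o)

  ∣⇒pred[1+m/n]≡m/n : ∀ {m n} .{{_ : NonZero n}} → n ∣ suc m → pred (suc m / n) ≡ m / n
  ∣⇒pred[1+m/n]≡m/n {m} {n} n∣1+m = ≤-antisym
    (subst (_≤ m / n) ([m∸n]/n≡m/n∸1 (suc m) n)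
      (/-monoˡ-≤ n (∸-monoʳ-≤ (suc m) (ℕ.>-nonZero⁻¹ n))))
    (<⇒≤pred (m<n*o⇒m/o<n {n = suc m / n} (≤-reflexive (sym (m/n*n≡m n∣1+m)))))

  ∤⇒[1+m]/n≡m/n : ∀ {m n} .{{_ : NonZero n}} → ¬ n ∣ suc m → suc m / n ≡ m / n
  ∤⇒[1+m]/n≡m/n {m} {n} n∤1+m = ≤-antisym
    (m*n≤o⇒m≤o/n (m<1+n⇒m≤n (≤∧≢⇒< (m/n*n≤m (suc m) n)
      λ eq → n∤1+m (divides (suc m / n) (sym eq)))))
    (/-monoˡ-≤ n (n≤1+n m))

-- Edits and the Levenshtein distance

Edit-sym : ∀ {z w} → Edit z w → Edit w z
Edit-sym (substitution u x y v) = substitution u y x v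
Edit-sym (deletion u x v)       = insertion u x v
Edit-sym (insertion u x v)      = deletion u x v

Edits-snoc : ∀ {k z w z′} → Edits k z w → Edit w z′ → Edits (suc k) z z′
Edits-snoc []       e′ = e′ ∷ []
Edits-snoc (e ∷ es) e′ = e ∷ Edits-snoc es e′

Edits-sym : ∀ {k z w} → Edits k z w → Edits k w z
Edits-sym []       = []
Edits-sym (e ∷ es) = Edits-snoc (Edits-sym es) (Edit-sym e)

Edits-++ˡ : ∀ u {k z w} → Edits k z w → Edits k (u ++ z) (u ++ w)
Edits-++ˡ []      es = es
Edits-++ˡ (x ∷ u) es = Edits-cons x (Edits-++ˡ u es)

Edits-overwrite : ∀ {s s′} v → length s ≤ length s′ → Edits (length s′) (s ++ v) (s′ ++ v)
Edits-overwrite {[]}    {[]}     v _         = []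
Edits-overwrite {[]}    {y ∷ s′} v _         = insertion [] y v ∷ Edits-cons y (Edits-overwrite v z≤n)
Edits-overwrite {x ∷ s} {y ∷ s′} v (s≤s s≤s′) =
  substitution [] x y (s ++ v) ∷ Edits-cons y (Edits-overwrite v s≤s′)

levenshtein-≤ : ∀ {k z w} → Edits k z w → levenshtein z w ≤ k
levenshtein-≤ {k} {z} {w} = proj₂ (proj₂ (minimalEdits z w)) k

levenshtein-edits : ∀ z w → Edits (levenshtein z w) z w
levenshtein-edits z w = proj₁ (proj₂ (minimalEdits z w))

count : Letter → Word → ℕ
count x w = length (filter (x ≟ᴸ_) w)

module _ where

  open import Data.Nat using (_+_)

  count-++ : ∀ x u v → count x (u ++ v) ≡ count x u + count x v
  count-++ x u v = trans (cong length (filter-++ (x ≟ᴸ_) u v)) (length-++ (filter (x ≟ᴸ_) u))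

  length≡count : ∀ w → length w ≡ count a w + count b w
  length≡count []      = refl
  length≡count (a ∷ w) = cong suc (length≡count w)
  length≡count (b ∷ w) = trans (cong suc (length≡count w)) (sym (+-suc (count a w) (count b w)))

  count-replace : ∀ x u s s′ v →
    ∣ count x (u ++ s ++ v) - count x (u ++ s′ ++ v) ∣ ≤ length s ⊔ length s′
  count-replace x u s s′ v = begin
    ∣ count x (u ++ s ++ v) - count x (u ++ s′ ++ v) ∣
      ≡⟨ cong₂ ∣_-_∣ (count-++ x u (s ++ v)) (count-++ x u (s′ ++ v)) ⟩
    ∣ count x u + count x (s ++ v) - count x u + count x (s′ ++ v) ∣
      ≡⟨ ∣m+n-m+o∣≡∣n-o∣ (count x u) _ _ ⟩
    ∣ count x (s ++ v) - count x (s′ ++ v) ∣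
      ≡⟨ cong₂ ∣_-_∣ (count-++ʳ s) (count-++ʳ s′) ⟩
    ∣ count x v + count x s - count x v + count x s′ ∣
      ≡⟨ ∣m+n-m+o∣≡∣n-o∣ (count x v) _ _ ⟩
    ∣ count x s - count x s′ ∣
      ≤⟨ ∣m-n∣≤m⊔n (count x s) (count x s′) ⟩
    count x s ⊔ count x s′
      ≤⟨ ⊔-mono-≤ (length-filter (x ≟ᴸ_) s) (length-filter (x ≟ᴸ_) s′) ⟩
    length s ⊔ length s′  ∎
    where
    open ≤-Reasoning
    count-++ʳ : ∀ w → count x (w ++ v) ≡ count x v + count x w
    count-++ʳ w = trans (count-++ x w v) (+-comm (count x w) (count x v))

count-Edit : ∀ x {z w} → Edit z w → ∣ count x z - count x w ∣ ≤ 1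
count-Edit x (substitution u y y′ v) = count-replace x u [ y ] [ y′ ] v
count-Edit x (deletion u y v)        = count-replace x u [ y ] [] v
count-Edit x (insertion u y v)       = count-replace x u [] [ y ] v

count-Edits : ∀ x {k z w} → Edits k z w → ∣ count x z - count x w ∣ ≤ k
count-Edits x {z = z}     []                 = ≤-reflexive (∣n-n∣≡0 (count x z))
count-Edits x {z = z} {w} (_∷_ {w = y} e es) =
  ≤-trans (∣-∣-triangle (count x z) (count x y) (count x w)) (+-mono-≤ (count-Edit x e) (count-Edits x es))

count-levenshtein : ∀ x z w → ∣ count x z - count x w ∣ ≤ levenshtein z w
count-levenshtein x z w = count-Edits x (levenshtein-edits z w)

-- Catenary degrees and factorizations

module _ (n : ℕ) where

  unique⇒IsCatenaryDegreeAt-0 : ∀ d x →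
    (∀ z w → IsFactorization n x z → IsFactorization n x w → z ≡ w) →
    IsCatenaryDegreeAt n d x (fin 0)
  unique⇒IsCatenaryDegreeAt-0 d x unique =
      (λ z w fz fw → subst (Star _ z) (unique z w fz fw) ε)
    , λ { ⊤⁺ _ → _ ≤⊤⁺ ; [ j ]⁺ _ → [ z≤n ]≤ }

  attained-bound⇒IsCatenaryDegree : ∀ d N x₀ →
    (∀ x → ∃ λ c → IsCatenaryDegreeAt n d x c × c ≤∞ N) →
    IsCatenaryDegreeAt n d x₀ N → IsCatenaryDegree n d N
  attained-bound⇒IsCatenaryDegree d N x₀ bounded (_ , N-least) =
      (λ x → proj₁ (bounded x))
    , (λ x → proj₁ (proj₂ (bounded x)))
    , (λ x → proj₂ (proj₂ (bounded x)))
    , λ u bound → ≤⁺-trans ≤-trans (N-least _ (proj₁ (proj₁ (proj₂ (bounded x₀))))) (bound x₀)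

  ∼-reflexive : ∀ {u v} → u ≡ v → u ∼⟨ n ⟩ v
  ∼-reflexive refl = ∼-refl

  π∼ : ∀ z → π n z ∼⟨ n ⟩ z
  π∼ z = ∼-reflexive (concat-map-[ z ])

  factorization⇒∼ : ∀ {x} z → IsFactorization n x z → z ∼⟨ n ⟩ x
  factorization⇒∼ z fz = ∼-trans (∼-sym (π∼ z)) fz

  ∼⇒factorization : ∀ {x} z → z ∼⟨ n ⟩ x → IsFactorization n x z
  ∼⇒factorization z z∼x = ∼-trans (π∼ z) z∼x

  halfFactorial⇒n≡2 : HalfFactorial n → n ≡ 2
  halfFactorial⇒n≡2 hf with hf (b ∷ a ∷ [])
  ... | _ , _ , unique = trans (sym (unique n∈L)) (unique 2∈L)
    where
    n∈L : L n (b ∷ a ∷ []) n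
    n∈L = replicate n b , ∼⇒factorization (replicate n b) (∼-sym ba∼bⁿ) , length-replicate n
    2∈L : L n (b ∷ a ∷ []) 2
    2∈L = b ∷ a ∷ [] , ∼-refl , refl

-- Normal forms

absorbed : Word → ℕ
absorbed []      = 0
absorbed (a ∷ w) = absorbed w
absorbed (b ∷ w) = count a w

count-a-normalForm : ∀ n k m → count a (normalForm n k m) ≡ k
count-a-normalForm n zero    zero    = refl
count-a-normalForm n zero    (suc m) = count-a-normalForm n zero m
count-a-normalForm n (suc k) m       = cong suc (count-a-normalForm n k m)

replicate-b-++-normalForm : ∀ n j m → replicate j b ++ normalForm n 0 m ≡ normalForm n 0 (j ℕ.+ m)
replicate-b-++-normalForm n zero    m = refl
replicate-b-++-normalForm n (suc j) m = cong (b ∷_) (replicate-b-++-normalForm n j m)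

module _ (p : ℕ) where

  open import Data.Nat using (_+_; _*_)

  private
    n : ℕ
    n = suc p

  leftMul : Letter → ℕ × ℕ → ℕ × ℕ
  leftMul a (k , m) = suc k , m
  leftMul b (k , m) = 0 , suc (k * p + m)

  exponents : Word → ℕ × ℕ
  exponents = foldr leftMul (0 , 0)

  a-exponent b-exponent : Word → ℕ
  a-exponent = proj₁ ∘ exponents
  b-exponent = proj₂ ∘ exponents

  normalise : Word → Word
  normalise w = uncurry (normalForm n) (exponents w)

  exponents-normalForm : ∀ k m → exponents (normalForm n k m) ≡ (k , m)
  exponents-normalForm zero    zero    = refl
  exponents-normalForm zero    (suc m) = cong (leftMul b) (exponents-normalForm zero m)
  exponents-normalForm (suc k) m       = cong (leftMul a) (exponents-normalForm k m)

  leftMul-bs : ∀ j k m → foldr leftMul (k , m) (replicate (suc j) b) ≡ (0 , suc j + (k * p + m))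
  leftMul-bs zero    k m = refl
  leftMul-bs (suc j) k m = cong (leftMul b) (leftMul-bs j k m)

  leftMul-resp-∼ : ∀ {u v} → u ∼⟨ n ⟩ v → ∀ s → foldr leftMul s u ≡ foldr leftMul s v
  leftMul-resp-∼ ba∼bⁿ (k , m) =
    trans (cong (λ j → 0 , suc j) (+-assoc p (k * p) m)) (sym (leftMul-bs p k m))
  leftMul-resp-∼ ∼-refl              s = refl
  leftMul-resp-∼ (∼-sym v∼u)         s = sym (leftMul-resp-∼ v∼u s)
  leftMul-resp-∼ (∼-trans u∼w w∼v)   s = trans (leftMul-resp-∼ u∼w s) (leftMul-resp-∼ w∼v s)
  leftMul-resp-∼ (∼-cong {u = u} {u′} {v} {v′} u∼u′ v∼v′) s = begin
    foldr leftMul s (u ++ v)               ≡⟨ foldr-++ leftMul s u v ⟩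
    foldr leftMul (foldr leftMul s v) u    ≡⟨ cong (λ t → foldr leftMul t u) (leftMul-resp-∼ v∼v′ s) ⟩
    foldr leftMul (foldr leftMul s v′) u   ≡⟨ leftMul-resp-∼ u∼u′ _ ⟩
    foldr leftMul (foldr leftMul s v′) u′  ≡⟨ foldr-++ leftMul s u′ v′ ⟨
    foldr leftMul s (u′ ++ v′)             ∎
    where open ≡-Reasoning

  factorization⇒exponents≡ : ∀ {x} z → IsFactorization n x z → exponents z ≡ exponents x
  factorization⇒exponents≡ z fz = leftMul-resp-∼ (factorization⇒∼ n z fz) (0 , 0)

  factorizations⇒exponents≡ : ∀ {x} z w → IsFactorization n x z → IsFactorization n x w →
    exponents z ≡ exponents w
  factorizations⇒exponents≡ z w fz fw =
    trans (factorization⇒exponents≡ z fz) (sym (factorization⇒exponents≡ w fw))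

  count-a≡a-exponent+absorbed : ∀ w → count a w ≡ a-exponent w + absorbed w
  count-a≡a-exponent+absorbed []      = refl
  count-a≡a-exponent+absorbed (a ∷ w) = cong suc (count-a≡a-exponent+absorbed w)
  count-a≡a-exponent+absorbed (b ∷ w) = refl

  b-exponent≡count-b+absorbed : ∀ w → b-exponent w ≡ count b w + absorbed w * p
  b-exponent≡count-b+absorbed []      = refl
  b-exponent≡count-b+absorbed (a ∷ w) = b-exponent≡count-b+absorbed w
  b-exponent≡count-b+absorbed (b ∷ w) = cong suc (begin
    k * p + b-exponent w                  ≡⟨ cong (k * p +_) (b-exponent≡count-b+absorbed w) ⟩
    k * p + (count b w + absorbed w * p)  ≡⟨ regroup k (count b w) (absorbed w) p ⟩
    count b w + (k + absorbed w) * p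
      ≡⟨ cong (λ t → count b w + t * p) (count-a≡a-exponent+absorbed w) ⟨
    count b w + count a w * p             ∎)
    where
    open ≡-Reasoning
    k : ℕ
    k = a-exponent w
    regroup : ∀ k β t p → k * p + (β + t * p) ≡ β + (k + t) * p
    regroup = ℕ-Solver.solve-∀

  -- The length is k + m − t(p − 1), stated without subtraction.
  length-exponents : ∀ w →
    length w + absorbed w * p ≡ a-exponent w + b-exponent w + absorbed w
  length-exponents w = begin
    length w + t * p             ≡⟨ cong (_+ t * p) (length≡count w) ⟩
    count a w + count b w + t * p
      ≡⟨ cong (λ α → α + count b w + t * p) (count-a≡a-exponent+absorbed w) ⟩
    k + t + count b w + t * p    ≡⟨ regroup k t (count b w) (t * p) ⟩
    k + (count b w + t * p) + t  ≡⟨ cong (λ m → k + m + t) (b-exponent≡count-b+absorbed w) ⟨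
    k + b-exponent w + t         ∎
    where
    open ≡-Reasoning
    k t : ℕ
    k = a-exponent w
    t = absorbed w
    regroup : ∀ k t β s → k + t + β + s ≡ k + (β + s) + t
    regroup = ℕ-Solver.solve-∀

  -- With truncated predecessor, t * p ≤ pred m says t = 0 or t * p < m.
  absorbed-≤ : ∀ w → absorbed w * p ≤ pred (b-exponent w)
  absorbed-≤ []      = z≤n
  absorbed-≤ (a ∷ w) = absorbed-≤ w
  absorbed-≤ (b ∷ w) = begin
    count a w * p              ≤⟨ m≤n+m (count a w * p) (count b w) ⟩
    count b w + count a w * p  ≡⟨ cong pred (b-exponent≡count-b+absorbed (b ∷ w)) ⟨
    pred (b-exponent (b ∷ w))  ∎
    where open ≤-Reasoning

  b-exponent≤p⇒≡normalise : ∀ w → b-exponent w ≤ p → w ≡ normalise w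
  b-exponent≤p⇒≡normalise []      _   = refl
  b-exponent≤p⇒≡normalise (a ∷ w) m≤p = cong (a ∷_) (b-exponent≤p⇒≡normalise w m≤p)
  b-exponent≤p⇒≡normalise (b ∷ w) m≤p = trans
    (cong (b ∷_) (b-exponent≤p⇒≡normalise w (≤-trans (m≤n+m _ _) (<⇒≤ m≤p))))
    (b∷normalForm (a-exponent w) (b-exponent w) m≤p)
    where
    b∷normalForm : ∀ k m → k * p + m < p → b ∷ normalForm n k m ≡ normalForm n 0 (suc (k * p + m))
    b∷normalForm zero    m _    = refl
    b∷normalForm (suc k) m m<p =
      contradiction (≤-<-trans (≤-trans (m≤m+n p (k * p)) (m≤m+n (p + k * p) m)) m<p) (n≮n p)

  levenshtein<p⇒absorbed≡ : ∀ z w →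
    exponents z ≡ exponents w → levenshtein z w < p → absorbed z ≡ absorbed w
  levenshtein<p⇒absorbed≡ z w eq d<p =
    ∣m-n∣≡0⇒m≡n (n<1⇒n≡0 (*-cancelʳ-< p ∣ absorbed z - absorbed w ∣ 1 (begin-strict
      ∣ absorbed z - absorbed w ∣ * p      ≡⟨ *-distribʳ-∣-∣ p (absorbed z) (absorbed w) ⟩
      ∣ absorbed z * p - absorbed w * p ∣  ≡⟨ m+s≡n+t⇒∣m-n∣≡∣s-t∣ (count b z) (count b w) same-weight ⟨
      ∣ count b z - count b w ∣            ≤⟨ count-levenshtein b z w ⟩
      levenshtein z w                      <⟨ d<p ⟩
      p                                    ≡⟨ *-identityˡ p ⟨
      1 * p                                ∎)))
    where
    open ≤-Reasoning
    same-weight : count b z + absorbed z * p ≡ count b w + absorbed w * p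
    same-weight = trans (sym (b-exponent≡count-b+absorbed z))
      (trans (cong proj₂ eq) (b-exponent≡count-b+absorbed w))

length≡exponents-2 : ∀ w → length w ≡ a-exponent 1 w ℕ.+ b-exponent 1 w
length≡exponents-2 w = +-cancelʳ-≡ (absorbed w) _ _
  (trans (cong (length w ℕ.+_) (sym (*-identityʳ (absorbed w)))) (length-exponents 1 w))

halfFactorial-2 : HalfFactorial 2
halfFactorial-2 x = length x , (x , ∼⇒factorization 2 x ∼-refl , refl) , λ { (z , fz , refl) → begin
  length x                           ≡⟨ length≡exponents-2 x ⟩
  a-exponent 1 x ℕ.+ b-exponent 1 x  ≡⟨ cong (uncurry ℕ._+_) (factorization⇒exponents≡ 1 z fz) ⟨
  a-exponent 1 z ℕ.+ b-exponent 1 z  ≡⟨ length≡exponents-2 z ⟨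
  length z                           ∎ }
  where open ≡-Reasoning

module _ (p : ℕ) .{{_ : NonZero p}} where

  open import Data.Nat using (_+_; _*_; _/_)

  private
    n : ℕ
    n = suc p

  Step : Word → Word → Set
  Step z w = z ∼⟨ n ⟩ w × Edits p z w

  Step-sym : ∀ {z w} → Step z w → Step w z
  Step-sym (z∼w , es) = ∼-sym z∼w , Edits-sym es

  Step-++ˡ : ∀ u {z w} → Step z w → Step (u ++ z) (u ++ w)
  Step-++ˡ u (z∼w , es) = ∼-cong (∼-refl {u = u}) z∼w , Edits-++ˡ u es

  ba⇒bⁿ : ∀ v → Step (b ∷ a ∷ v) (replicate n b ++ v)
  ba⇒bⁿ v = ∼-cong ba∼bⁿ (∼-refl {u = v}) , Edits-cons b a⇒bᵖ
    where
    a⇒bᵖ : Edits p (a ∷ v) (replicate p b ++ v)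
    a⇒bᵖ = subst (λ k → Edits k (a ∷ v) (replicate p b ++ v)) (length-replicate p)
      (Edits-overwrite {[ a ]} v (subst (1 ≤_) (sym (length-replicate p)) (ℕ.>-nonZero⁻¹ p)))

  b∷normalForm-steps : ∀ k m → Star Step (b ∷ normalForm n k m) (normalForm n 0 (suc (k * p + m)))
  b∷normalForm-steps zero    m = ε
  b∷normalForm-steps (suc k) m = ba⇒bⁿ (normalForm n k m) ◅
    subst₂ (Star Step) (replicate-∷ p b (normalForm n k m)) bᵖ++≡
      (Star.gmap (replicate p b ++_) (Step-++ˡ (replicate p b)) (b∷normalForm-steps k m))
    where
    open ≡-Reasoning
    bᵖ++≡ : replicate p b ++ normalForm n 0 (suc (k * p + m)) ≡ normalForm n 0 (suc (suc k * p + m))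
    bᵖ++≡ = begin
      replicate p b ++ normalForm n 0 (suc (k * p + m))  ≡⟨ replicate-b-++-normalForm n p _ ⟩
      normalForm n 0 (p + suc (k * p + m))
        ≡⟨ cong (normalForm n 0) (trans (+-suc p _) (cong suc (sym (+-assoc p (k * p) m)))) ⟩
      normalForm n 0 (suc (suc k * p + m))               ∎

  normalise-steps : ∀ w → Star Step w (normalise p w)
  normalise-steps []      = ε
  normalise-steps (a ∷ w) = Star.gmap (a ∷_) (Step-++ˡ [ a ]) (normalise-steps w)
  normalise-steps (b ∷ w) =
    Star.gmap (b ∷_) (Step-++ˡ [ b ]) (normalise-steps w) ◅◅ uncurry b∷normalForm-steps (exponents p w)

  exponents≡⇒steps : ∀ z w → exponents p z ≡ exponents p w → Star Step z w
  exponents≡⇒steps z w eq =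
    subst (Star Step z ∘ uncurry (normalForm n)) eq (normalise-steps z)
      ◅◅ Star.reverse Step-sym (normalise-steps w)

  exponents≡⇒factorization : ∀ {x} z → exponents p z ≡ exponents p x → IsFactorization n x z
  exponents≡⇒factorization {x} z eq = ∼⇒factorization n z
    (Star.fold (_∼⟨ n ⟩_) (∼-trans ∘ proj₁) ∼-refl (exponents≡⇒steps z x eq))

  absorbing-factorization : ∀ x t → t * p ≤ pred (b-exponent p x) →
    ∃ λ z → IsFactorization n x z × absorbed z ≡ t
  absorbing-factorization x t t≤ =
    let (z , eq , absorbed≡t) = absorbing-word (a-exponent p x) (b-exponent p x) t≤
    in z , exponents≡⇒factorization z eq , absorbed≡t
    where
    absorbing-word : ∀ k m → t * p ≤ pred m → ∃ λ z → exponents p z ≡ (k , m) × absorbed z ≡ t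
    absorbing-word (suc k) m t≤ =
      let (z , eq , absorbed≡t) = absorbing-word k m t≤ in a ∷ z , cong (leftMul p a) eq , absorbed≡t
    absorbing-word zero zero    t≤ = [] , refl , sym (m*n≡0⇒m≡0 t p (n≤0⇒n≡0 t≤))
    absorbing-word zero (suc m) t≤ =
        b ∷ normalForm n t (m ∸ t * p)
      , trans (cong (leftMul p b) (exponents-normalForm p t (m ∸ t * p)))
          (cong (λ j → 0 , suc j) (m+[n∸m]≡n t≤))
      , count-a-normalForm n t (m ∸ t * p)

  -- The catenary degree

  steps⇒links : ∀ {x z w} → IsFactorization n x z → Star Step z w → Star (Link n levenshtein x (fin p)) z w
  steps⇒links fz ε = ε
  steps⇒links fz (_◅_ {z} {w} (z∼w , es) steps) =
    (fz , fw , [ levenshtein-≤ es ]≤) ◅ steps⇒links fw steps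
    where
    fw : IsFactorization n _ w
    fw = ∼⇒factorization n w (∼-trans (∼-sym z∼w) (factorization⇒∼ n z fz))

  ChainConnected-p : ∀ x → ChainConnected n levenshtein x (fin p)
  ChainConnected-p x z w fz fw =
    steps⇒links fz (exponents≡⇒steps z w (factorizations⇒exponents≡ p z w fz fw))

  link⇒absorbed≡ : ∀ {x j} z w → j < p → Link n levenshtein x (fin j) z w → absorbed z ≡ absorbed w
  link⇒absorbed≡ z w j<p (fz , fw , d≤j) = levenshtein<p⇒absorbed≡ p z w
    (factorizations⇒exponents≡ p z w fz fw)
    (≤-<-trans ([≤]-injective d≤j) j<p)

  ChainConnected⇒p≤ : ∀ x N → p < b-exponent p x → ChainConnected n levenshtein x N → fin p ≤∞ N
  ChainConnected⇒p≤ x ⊤⁺     p<m connected = _ ≤⊤⁺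
  ChainConnected⇒p≤ x [ j ]⁺ p<m connected with p ≤? j
  ... | yes p≤j = [ p≤j ]≤
  ... | no  p≰j =
    let (z₀ , fz₀ , absorbed≡0) = absorbing-factorization x 0 z≤n
        (z₁ , fz₁ , absorbed≡1) = absorbing-factorization x 1
          (subst (_≤ pred (b-exponent p x)) (sym (*-identityˡ p)) (<⇒≤pred p<m))
        absorbed≡ = Star.fold (λ z w → absorbed z ≡ absorbed w)
          (λ {z} {w} link → trans (link⇒absorbed≡ z w (≰⇒> p≰j) link)) refl (connected z₀ z₁ fz₀ fz₁)
    in contradiction (trans (sym absorbed≡0) (trans absorbed≡ absorbed≡1)) λ ()

  p<b-exponent⇒IsCatenaryDegreeAt-p : ∀ x → p < b-exponent p x → IsCatenaryDegreeAt n levenshtein x (fin p)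
  p<b-exponent⇒IsCatenaryDegreeAt-p x p<m = ChainConnected-p x , λ N → ChainConnected⇒p≤ x N p<m

  b-exponent≤p⇒IsCatenaryDegreeAt-0 : ∀ x → b-exponent p x ≤ p → IsCatenaryDegreeAt n levenshtein x (fin 0)
  b-exponent≤p⇒IsCatenaryDegreeAt-0 x m≤p = unique⇒IsCatenaryDegreeAt-0 n levenshtein x
    λ z w fz fw → trans (≡normalise z fz) (sym (≡normalise w fw))
    where
    ≡normalise : ∀ z → IsFactorization n x z → z ≡ normalise p x
    ≡normalise z fz = trans
      (b-exponent≤p⇒≡normalise p z (subst (λ s → proj₂ s ≤ p) (sym (factorization⇒exponents≡ p z fz)) m≤p))
      (cong (uncurry (normalForm n)) (factorization⇒exponents≡ p z fz))

  catenaryDegree : IsCatenaryDegree n levenshtein (fin p)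
  catenaryDegree = attained-bound⇒IsCatenaryDegree n levenshtein (fin p) bⁿ bounded
    (p<b-exponent⇒IsCatenaryDegreeAt-p bⁿ (≤-reflexive (cong proj₂ (sym (exponents-normalForm p 0 n)))))
    where
    bⁿ : Word
    bⁿ = normalForm n 0 n
    bounded : ∀ x → ∃ λ c → IsCatenaryDegreeAt n levenshtein x c × c ≤∞ fin p
    bounded x with p <? b-exponent p x
    ... | yes p<m = fin p , p<b-exponent⇒IsCatenaryDegreeAt-p x p<m , [ ≤-refl ]≤
    ... | no  p≮m = fin 0 , b-exponent≤p⇒IsCatenaryDegreeAt-0 x (≮⇒≥ p≮m) , [ z≤n ]≤

  -- Sets of lengths

  L⇒absorbed : ∀ {x k m l} → exponents p x ≡ (k , m) → L n x l →
    ∃ λ t → t * p ≤ pred m × l + t * p ≡ k + m + t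
  L⇒absorbed {x} eqx (z , fz , refl) with trans (factorization⇒exponents≡ p z fz) eqx
  ... | refl = absorbed z , absorbed-≤ p z , length-exponents p z

  absorbed⇒L : ∀ {x k m} t → exponents p x ≡ (k , m) → t * p ≤ pred m →
    ∃ λ l → L n x l × l + t * p ≡ k + m + t
  absorbed⇒L {x} t refl t≤ with absorbing-factorization x t t≤
  ... | z , fz , refl = length z , (z , fz , refl) , trans (length-exponents p z)
    (cong (λ s → uncurry _+_ s + t) (factorization⇒exponents≡ p z fz))

  q≡pred/ : ∀ m .(2≤n : 2 ≤ n) → q m n 2≤n ≡ pred m / p
  q≡pred/ zero    2≤n = sym (0/n≡0 p)
  q≡pred/ (suc m) 2≤n with p ∣? suc m
  ... | yes p∣1+m = ∣⇒pred[1+m/n]≡m/n p∣1+m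
  ... | no  p∤1+m = ∤⇒[1+m]/n≡m/n p∤1+m

  ≤q⇔*≤pred : ∀ t m .(2≤n : 2 ≤ n) → t ≤ q m n 2≤n ⇔ t * p ≤ pred m
  ≤q⇔*≤pred t m 2≤n rewrite q≡pred/ m 2≤n = mk⇔
    (λ t≤ → ≤-trans (*-monoˡ-≤ p t≤) (m/n*n≤m (pred m) p))
    m*n≤o⇒m≤o/n

open import Data.Integer using (ℤ; +_; _+_; _-_; _*_; +≤+)
open import Data.Integer.Properties using (pos-*)
import Data.Integer.Tactic.RingSolver as ℤ-Solver

module _ (p : ℕ) .{{_ : NonZero p}} where

  private
    n : ℕ
    n = suc p

  length≡progression-term : ∀ k m {l t i Q} → l ℕ.+ t ℕ.* p ≡ k ℕ.+ m ℕ.+ t → t ℕ.+ i ≡ Q →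
    + l ≡ ((+ k + + m) - + Q * (+ n - + 2)) + (+ n - + 2) * + i
  length≡progression-term k m {l} {t} {i} eq refl = begin
    + l                                                            ≡⟨ add-subtract (+ l) (+ t * + p) ⟩
    (+ l + + t * + p) - + t * + p                                  ≡⟨ cong (_- + t * + p) eqℤ ⟩
    (+ k + + m + + t) - + t * + p                                  ≡⟨ regroup (+ k) (+ m) (+ t) (+ i) (+ p) ⟩
    ((+ k + + m) - + (t ℕ.+ i) * (+ n - + 2)) + (+ n - + 2) * + i  ∎
    where
    open ≡-Reasoning
    eqℤ : + l + + t * + p ≡ + k + + m + + t
    eqℤ = trans (cong (λ s → + l + s) (sym (pos-* t p))) (cong +_ eq)
    add-subtract : ∀ l s → l ≡ (l + s) - s
    add-subtract = ℤ-Solver.solve-∀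
    regroup : ∀ k m t i p →
      (k + m + t) - t * p ≡ ((k + m) - (t + i) * (+ 1 + p - + 2)) + (+ 1 + p - + 2) * i
    regroup = ℤ-Solver.solve-∀

  L-normalForm : ∀ (2≤n : 2 ≤ n) k m →
    asℤ (L n (normalForm n k m))
      ≐ ((+ k + + m) - + q m n 2≤n * (+ n - + 2)) +ˢ (+ n - + 2) ·ˢ [ + 0 ⋯ + q m n 2≤n ]
  L-normalForm 2≤n k m = L⊆progression , progression⊆L
    where
    Q : ℕ
    Q = q m n 2≤n
    progression : Pred ℤ 0ℓ
    progression = ((+ k + + m) - + Q * (+ n - + 2)) +ˢ (+ n - + 2) ·ˢ [ + 0 ⋯ + Q ]

    L⊆progression : asℤ (L n (normalForm n k m)) ⊆ progression
    L⊆progression (l , l∈L , refl) =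
      let (t , t≤ , l+tp≡) = L⇒absorbed p (exponents-normalForm p k m) l∈L
          t≤Q = Equivalence.from (≤q⇔*≤pred p t m 2≤n) t≤
      in _ , (+ (Q ∸ t) , (+≤+ z≤n , +≤+ (m∸n≤m Q t)) , refl)
           , length≡progression-term k m l+tp≡ (m+[n∸m]≡n t≤Q)

    progression⊆L : progression ⊆ asℤ (L n (normalForm n k m))
    progression⊆L (_ , (_ , (+≤+ {n = i} _ , +≤+ i≤Q) , refl) , refl) =
      let t≤ = Equivalence.to (≤q⇔*≤pred p (Q ∸ i) m 2≤n) (m∸n≤m Q i)
          (l , l∈L , l+tp≡) = absorbed⇒L p (Q ∸ i) (exponents-normalForm p k m) t≤
      in l , l∈L , sym (length≡progression-term k m l+tp≡ (m∸n+n≡m i≤Q))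

theorem4p1 : (n : ℕ) (2≤n : 2 ≤ n) →
    (IsCatenaryDegree n levenshtein (fin (n ∸ 1)) × (HalfFactorial n ⇔ n ≡ 2))
    × (∀ (k m : ℕ) →
        asℤ (L n (normalForm n k m))
          ≐ ((+ k + + m) - + q m n 2≤n * (+ n - + 2))
              +ˢ (+ n - + 2) ·ˢ [ + 0 ⋯ + q m n 2≤n ])
theorem4p1 n@(suc p@(suc _)) 2≤n@(s≤s (s≤s _)) =
  (catenaryDegree p , mk⇔ (halfFactorial⇒n≡2 n) λ { refl → halfFactorial-2 }) , L-normalForm p 2≤n
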